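{- There exist a constant specification $\mathsf{CS}$ for $\mathsf{JNoC}$, a NoC $\mathsf{CS}$-subset model $\mathcal{M}=(W,W_0,V,E)$ and a world $\omega\in W_0$ such that \[ \mathcal{M},\omega\Vdash t:\perp \] for some term $t$.
   Context: **Syntax.** Justification terms are built from countably many constants $c_i$ and countably many variables $x_i$ by $t::=c_i\mid x_i\mid t\cdot t\mid (t+t)\mid\, !t$; the set of terms is $\mathsf{Tm}$. Formulas are built from countably many atomic propositions $P_i$ and $\perp$ by $F::=P_i\mid\perp\mid F\to F\mid t:F$; the set of formulas is $\mathcal{L}_J$. The other Boolean connectives are defined as usual from $\to,\perp$; in particular $\neg A:=A\to\perp$. The axioms of $\mathsf{JNoC}$ are (for all terms $s,t$ and formulas $A,B$): (cl) all axioms of classical propositional logic (in the language $\mathcal{L}_J$); (j+) $s:A\lor t:A\to (s+t):A$; (j) $s:(A\to B)\to(t:A\to s\cdot t:B)$; (noc) $\neg(t:A\land t:\neg A)$. A constant specification for $\mathsf{JNoC}$ is a set $\mathsf{CS}\subseteq\{(c,A)\mid c\text{ a constant and }A\text{ an axiom of }\mathsf{JNoC}\}$. Write $!^n c$ for $c$ prefixed by $n$ copies of $!$. **Semantics.** A NoC $\mathsf{CS}$-subset model is $\mathcal{M}=(W,W_0,V,E)$ where $W$ is a set (of worlds), $W_0\subseteq W$, $W_0\neq\emptyset$, and: - $V:W\times\mathcal{L}_J\to\{0,1\}$ is such that for all $\omega\in W_0$, $t\in\mathsf{Tm}$, $F,G\in\mathcal{L}_J$: $V(\omega,\perp)=0$;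 $V(\omega,F\to G)=1$ iff $V(\omega,F)=0$ or $V(\omega,G)=1$; $V(\omega,t:F)=1$ iff $E(\omega,t)\subseteq[F]$, where $[F]:=\{\upsilon\in W\mid V(\upsilon,F)=1\}$. (No conditions are imposed on $V$ at worlds outside $W_0$.) - $E:W\times\mathsf{Tm}\to\mathcal{P}(W)$ is such that for all $\omega\in W_0$ and $s,t\in\mathsf{Tm}$: (1) $E(\omega,s+t)\subseteq E(\omega,s)\cap E(\omega,t)$; (2) $E(\omega,s\cdot t)\subseteq\{\upsilon\in W\mid \forall F\in\mathsf{APP}_\omega(s,t)\ (\upsilon\in[F])\}$, where $\mathsf{APP}_\omega(s,t):=\{F\in\mathcal{L}_J\mid \exists H\in\mathcal{L}_J \text{ with } E(\omega,s)\subseteq[H\to F]\text{ and }E(\omega,t)\subseteq[H]\}$; (3) there exists $\upsilon\in W_{\mathsf{nc}}$ with $\upsilon\in E(\omega,t)$, where $W_{\mathsf{nc}}:=\{\upsilon\in W\mid \text{for all formulas }A:\ V(\upsilon,A)=0\text{ or }V(\upsilon,\neg A)=0\}$; (4) for all $(c,A)\in\mathsf{CS}$: $E(\omega,c)\subseteq[A]$, and for all $n\geq 1$, $E(\omega,!^n c)\subseteq[!^{n-1}c:\cdots:\,!c:c:A]$. Truth: $\mathcal{M},\omega\Vdash F$ iff $V(\omega,F)=1$. -}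

module Defs where

open import Data.Bool.Base using (Bool; true; false)
open import Data.Nat.Base using (ℕ; zero; suc; _≥_)
open import Data.Product.Base using (_×_; _,_; ∃-syntax)
open import Data.Sum.Base using (_⊎_)
open import Function.Bundles using (_⇔_)
open import Level using (0ℓ)
open import Relation.Binary.PropositionalEquality using (_≡_)
open import Relation.Unary using (Pred; _∈_; _⊆_; _∩_; Satisfiable)

infixl 9 _·_
infixl 8 _⊕_
infix  10 !_
infixr 7 _∶_
infix  7 ~_
infixr 6 _∧'_
infixr 5 _∨'_
infixr 4 _⇒_

data Tm : Set where
  con : ℕ → Tm
  var : ℕ → Tm
  _·_ : Tm → Tm → Tm
  _⊕_ : Tm → Tm → Tm
  !_  : Tm → Tm

data Fm : Set where
  atom : ℕ → Fm
  bot  : Fm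
  _⇒_  : Fm → Fm → Fm
  _∶_  : Tm → Fm → Fm

~_ : Fm → Fm
~ A = A ⇒ bot

_∨'_ : Fm → Fm → Fm
A ∨' B = ~ A ⇒ B

_∧'_ : Fm → Fm → Fm
A ∧' B = ~ (A ⇒ ~ B)

-- The axioms of JNoC.  The first three schemes axiomatize classical
-- propositional logic (with modus ponens) over the primitives ⇒ and bot.
data Axiom : Pred Fm 0ℓ where
  cl-K : ∀ A B → Axiom (A ⇒ B ⇒ A)
  cl-S : ∀ A B C → Axiom ((A ⇒ B ⇒ C) ⇒ (A ⇒ B) ⇒ A ⇒ C)
  cl-N : ∀ A → Axiom (~ ~ A ⇒ A)
  j+   : ∀ s t A → Axiom (s ∶ A ∨' t ∶ A ⇒ (s ⊕ t) ∶ A)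
  j    : ∀ s t A B → Axiom (s ∶ (A ⇒ B) ⇒ t ∶ A ⇒ (s · t) ∶ B)
  noc  : ∀ t A → Axiom (~ (t ∶ A ∧' t ∶ (~ A)))

-- A pair (c , A) refers to the constant by its index c, i.e. to con c.
record ConstantSpecification : Set₁ where
  field
    CS       : Pred (ℕ × Fm) 0ℓ
    CS-axiom : ∀ {c A} → (c , A) ∈ CS → Axiom A

!^ : ℕ → ℕ → Tm
!^ zero    c = con c
!^ (suc n) c = ! (!^ n c)

-- tower n c A is !ⁿ⁻¹c : ⋯ : !c : c : A, with n terms in front of A.
tower : ℕ → ℕ → Fm → Fm
tower zero    c A = A
tower (suc n) c A = !^ n c ∶ tower n c A

record NoCSubsetModel (𝒞 : ConstantSpecification) : Set₁ where
  open ConstantSpecification 𝒞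
  field
    W  : Set
    W₀ : Pred W 0ℓ
    V  : W → Fm → Bool
    E  : W → Tm → Pred W 0ℓ

  [_] : Fm → Pred W 0ℓ
  [ F ] υ = V υ F ≡ true

  APP : W → Tm → Tm → Pred Fm 0ℓ
  APP ω s t F = ∃[ H ] (E ω s ⊆ [ H ⇒ F ] × E ω t ⊆ [ H ])

  Wnc : Pred W 0ℓ
  Wnc υ = ∀ A → V υ A ≡ false ⊎ V υ (~ A) ≡ false

  field
    W₀-nonempty : Satisfiable W₀

    V-bot : ∀ {ω} → ω ∈ W₀ → V ω bot ≡ false
    V-⇒   : ∀ {ω} → ω ∈ W₀ → ∀ F G →
            V ω (F ⇒ G) ≡ true ⇔ (V ω F ≡ false ⊎ V ω G ≡ true)
    V-∶   : ∀ {ω} → ω ∈ W₀ → ∀ t F →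
            V ω (t ∶ F) ≡ true ⇔ E ω t ⊆ [ F ]

    E-⊕   : ∀ {ω} → ω ∈ W₀ → ∀ s t → E ω (s ⊕ t) ⊆ E ω s ∩ E ω t
    E-·   : ∀ {ω} → ω ∈ W₀ → ∀ s t →
            E ω (s · t) ⊆ (λ υ → ∀ F → F ∈ APP ω s t → υ ∈ [ F ])
    E-noc : ∀ {ω} → ω ∈ W₀ → ∀ t → ∃[ υ ] (υ ∈ Wnc × υ ∈ E ω t)
    E-CS  : ∀ {ω} → ω ∈ W₀ → ∀ {c A} → (c , A) ∈ CS →
            E ω (con c) ⊆ [ A ]
    E-CS! : ∀ {ω} → ω ∈ W₀ → ∀ {c A} → (c , A) ∈ CS →
            ∀ n → n ≥ 1 → E ω (!^ n c) ⊆ [ tower n c A ]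

infix 3 _,_⊩_

_,_⊩_ : ∀ {𝒞} (M : NoCSubsetModel 𝒞) → NoCSubsetModel.W M → Fm → Set
M , ω ⊩ F = NoCSubsetModel.V M ω F ≡ true

{-# OPTIONS --safe #-}
-- Let every term have the single evidence world "absurd", outside W₀, at which
-- exactly the formula ⊥ is true.  It lies in W_nc, since ¬ ⊥ fails there and no
-- other formula holds, and condition (2) is vacuous, since no implication holds
-- there.  Hence t : ⊥ is true at the normal world for every t.
module Submission where

open import Data.Bool.Base using (Bool; true; false; not; _∨_)
open import Data.Product.Base using (Σ-syntax; ∃-syntax; _×_; _,_)
open import Data.Sum.Base using (_⊎_; inj₁; inj₂)
open import Defs
open import Function.Bundles using (_⇔_; mk⇔)
open import Relation.Binary.PropositionalEquality using (_≡_; refl)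
open import Relation.Nullary.Negation using (contradiction)
open import Relation.Unary using (_∈_; ∅)

data World : Set where
  normal absurd : World

isBot : Fm → Bool
isBot bot = true
isBot _   = false

val : World → Fm → Bool
val absurd F        = isBot F
val normal (atom _) = false
val normal bot      = false
val normal (F ⇒ G)  = not (val normal F) ∨ val normal G
-- Evidence sets are all the singleton of `absurd`, so inclusion in `[ F ]` reduces to truth of `F`
-- at `absurd`.
val normal (_ ∶ F)  = val absurd F

not-∨-true : ∀ b c → not b ∨ c ≡ true ⇔ (b ≡ false ⊎ c ≡ true)
not-∨-true false c = mk⇔ (λ _ → inj₁ refl) (λ _ → refl)
not-∨-true true  c = mk⇔ inj₂ λ { (inj₁ ()) ; (inj₂ p) → p }

-- A negation is an implication, never `bot` itself, so the right disjunct serves for every `A`.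
absurd-nc : ∀ A → val absurd A ≡ false ⊎ val absurd (~ A) ≡ false
absurd-nc _ = inj₂ refl

-- Every axiom is an implication, hence false at `absurd`, so any pair in `CS` would violate `E-CS`
-- in the model below.
emptyCS : ConstantSpecification
emptyCS = record { CS = ∅ ; CS-axiom = λ () }

model : NoCSubsetModel emptyCS
model = record
  { W           = World
  ; W₀          = _≡ normal
  ; V           = val
  ; E           = λ _ _ → _≡ absurd
  ; W₀-nonempty = normal , refl
  ; V-bot       = λ { refl → refl }
  ; V-⇒         = λ { refl F G → not-∨-true (val normal F) (val normal G) }
  ; V-∶         = λ { refl t F → mk⇔ (λ { p refl → p }) (λ e → e refl) }
  ; E-⊕         = λ _ _ _ p → p , p
  ; E-·         = λ { _ _ _ refl F (H , s⊆H⇒F , _) → contradiction (s⊆H⇒F refl) λ () }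
  ; E-noc       = λ _ _ → absurd , absurd-nc , refl
  ; E-CS        = λ _ ()
  ; E-CS!       = λ _ ()
  }

lemma23 : Σ[ 𝒞 ∈ ConstantSpecification ]
    Σ[ M ∈ NoCSubsetModel 𝒞 ]
    ∃[ ω ] (ω ∈ NoCSubsetModel.W₀ M × (∃[ t ] (M , ω ⊩ t ∶ bot)))
-- Any term would do in place of `con 0`.
lemma23 = emptyCS , model , normal , refl , con 0 , refl
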